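{- No countable intersection of tall analytic $P$-ideals on $\omega$ has the Ramsey property, and no countable intersection of ideals on $\omega$ each failing the ordinary Ramsey property has the Ramsey property; in particular, no countable intersection of topologically represented ideals has the Ramsey property.
   Context: All ideals on $\omega$ are proper and contain all finite sets; they are viewed as subsets of $2^\omega\cong\mathcal P(\omega)$, so "analytic" makes sense. $\mathcal I^+=\mathcal P(\omega)\setminus\mathcal I$. An ideal is tall if every infinite subset of $\omega$ has an infinite subset in the ideal. It is a $P$-ideal if for every sequence $(A_n)$ of its members there is a member $A$ with $A_n\setminus A$ finite for all $n$. $\mathcal I$ has the Ramsey property if for every $X\in\mathcal I^+$ and every $c:[X]^2\to2$ there is $Y\subseteq X$, $Y\in\mathcal I^+$, with $c\upharpoonright[Y]^2$ constant. $\mathcal I$ has the ordinary Ramsey property if this holds for $X=\omega$ only. An ideal $\mathcal J$ on $\omega$ is topologically represented if there are a compact metric space $K$, a dense $D\subseteq K$, a bijection $e:\omega\to D$ and a $\sigma$-ideal $\mathscr K$ of compact sets (compact subsets of $K$) such that for all $A\subseteq\omega$: $A\in\mathcal J\iff\overline{e[A]}\in\mathscr K$.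
   Formalization: σ-ideals of compact sets are additionally required to contain all singletons; without this, the finite subsets of ω in the compact space ω+1 represent Fin, which has the Ramsey property, so the last claim would be false. -}

module Defs where

open import Algebra.Core using (Op₂)
open import Data.Bool.Base using (Bool; true; T; _∨_; _∧_; not)
open import Data.List.Base using (List)
open import Data.List.Relation.Unary.Any using (Any)
import Data.List.Membership.Propositional as List
open import Data.Nat.Base as ℕ using (ℕ; _⊔_)
import Data.Nat.Properties as ℕ
open import Data.Product.Base using (_×_; _,_; ∃; ∃₂; proj₁; proj₂)
open import Data.Rational.Base as ℚ using (ℚ; 0ℚ; ½; ∣_∣)
import Data.Rational.Properties as ℚ
open import Data.Rational.Solver using (module +-*-Solver)
open import Data.Sum.Base using (_⊎_)
open import Function.Base using (const)
open import Function.Bundles using (_⇔_)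
open import Function.Definitions using (Injective)
open import Function.Metric.Structures using (IsGeneralMetric)
open import Level using (0ℓ; suc)
open import Relation.Binary.Core using (Rel)
open import Relation.Binary.Definitions using (_Respects_)
open import Relation.Binary.PropositionalEquality
  using (_≡_; _≗_; refl; sym; trans; cong; subst)
open import Relation.Binary.Structures using (IsPartialOrder)
open import Relation.Nullary.Negation using (¬_)
open import Relation.Unary using (Pred; _∈_; _⊆_; _≐_; ∁; U; ⋃; ⋂; Satisfiable)

𝒫ω : Set
𝒫ω = ℕ → Bool

El : 𝒫ω → Pred ℕ 0ℓ
El A n = T (A n)

ω : 𝒫ω
ω = const true

infix 4 _⊑_
infixl 6 _∪_ _∖_

_⊑_ : Rel 𝒫ω 0ℓ
A ⊑ B = El A ⊆ El B

_∪_ _∖_ : Op₂ 𝒫ω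
(A ∪ B) n = A n ∨ B n
(A ∖ B) n = A n ∧ not (B n)

Finite Infinite : Pred 𝒫ω 0ℓ
Finite A = ∃ λ (xs : List ℕ) → El A ⊆ (List._∈ xs)
Infinite A = ¬ Finite A

record Ideal : Set₁ where
  field
    Mem      : Pred 𝒫ω 0ℓ
    downward : ∀ {A B} → A ⊑ B → B ∈ Mem → A ∈ Mem
    union    : ∀ {A B} → A ∈ Mem → B ∈ Mem → A ∪ B ∈ Mem
    finite   : ∀ {A} → Finite A → A ∈ Mem
    proper   : ¬ (ω ∈ Mem)

open Ideal public using (Mem)

_⁺ : Ideal → Pred 𝒫ω 0ℓ
I ⁺ = ∁ (Mem I)

⋂ᴵ : (ℕ → Ideal) → Ideal
⋂ᴵ I = record
  { Mem      = ⋂ ℕ (λ n → Mem (I n))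
  ; downward = λ A⊑B B∈ n → Ideal.downward (I n) A⊑B (B∈ n)
  ; union    = λ A∈ B∈ n → Ideal.union (I n) (A∈ n) (B∈ n)
  ; finite   = λ fin n → Ideal.finite (I n) fin
  ; proper   = λ ω∈ → Ideal.proper (I 0) (ω∈ 0)
  }

Tall : Pred Ideal 0ℓ
Tall I = ∀ A → Infinite A → ∃ λ B → B ⊑ A × Infinite B × B ∈ Mem I

PIdeal : Pred Ideal 0ℓ
PIdeal I = (A : ℕ → 𝒫ω) → (∀ n → A n ∈ Mem I) →
           ∃ λ B → B ∈ Mem I × (∀ n → Finite (A n ∖ B))

Agree : {X : Set} → ℕ → Rel (ℕ → X) 0ℓ
Agree k x y = ∀ i → i ℕ.< k → x i ≡ y i

Continuous : Pred ((ℕ → ℕ) → 𝒫ω) 0ℓ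
Continuous f = ∀ x n → ∃ λ k → ∀ y → Agree k x y → Agree n (f x) (f y)

-- Analytic sets are the empty set and the continuous images of the Baire space.
Analytic : Pred (Pred 𝒫ω 0ℓ) 0ℓ
Analytic P = ¬ Satisfiable P
           ⊎ ∃ λ f → Continuous f × (∀ A → A ∈ P ⇔ (∃ λ x → f x ≗ A))

-- The unordered pairs in [X]² are listed in increasing order.
Colouring : 𝒫ω → Set
Colouring X = ∀ m n → m ∈ El X → n ∈ El X → m ℕ.< n → Bool

Homogeneous : ∀ {X Y} → Colouring X → Y ⊑ X → Set
Homogeneous {Y = Y} c Y⊑X = ∃ λ i →
  ∀ m n (m∈Y : m ∈ El Y) (n∈Y : n ∈ El Y) (m<n : m ℕ.< n) →
  c m n (Y⊑X m∈Y) (Y⊑X n∈Y) m<n ≡ i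

RamseyAt : Ideal → Pred 𝒫ω 0ℓ
RamseyAt I X = (c : Colouring X) →
  ∃₂ λ Y (Y⊑X : Y ⊑ X) → Y ∈ I ⁺ × Homogeneous c Y⊑X

Ramsey : Pred Ideal 0ℓ
Ramsey I = ∀ X → X ∈ I ⁺ → RamseyAt I X

OrdinaryRamsey : Pred Ideal 0ℓ
OrdinaryRamsey I = RamseyAt I ω

halve : ∀ {ε} → 0ℚ ℚ.< ε → 0ℚ ℚ.< ½ ℚ.* ε
halve {ε} 0<ε = subst (ℚ._< ½ ℚ.* ε) (ℚ.*-zeroʳ ½) (ℚ.*-monoʳ-<-pos ½ 0<ε)

halves : ∀ ε → ½ ℚ.* ε ℚ.+ ½ ℚ.* ε ≡ ε
halves ε = trans (sym (ℚ.*-distribʳ-+ ε ½ ½)) (ℚ.*-identityˡ ε)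

-- Cauchy sequences of rationals; equality of reals is _≃_.
record ℝ : Set where
  field
    seq    : ℕ → ℚ
    cauchy : ∀ ε → 0ℚ ℚ.< ε →
             ∃ λ N → ∀ m n → N ℕ.≤ m → N ℕ.≤ n → ∣ seq m ℚ.- seq n ∣ ℚ.< ε

open ℝ

infix 4 _≤_ _<_ _≃_
infixl 6 _+_

_≤_ _<_ _≃_ : Rel ℝ 0ℓ
x ≤ y = ∀ ε → 0ℚ ℚ.< ε → ∃ λ N → ∀ n → N ℕ.≤ n → seq x n ℚ.≤ seq y n ℚ.+ ε
x < y = ∃ λ ε → 0ℚ ℚ.< ε × ∃ λ N → ∀ n → N ℕ.≤ n → seq x n ℚ.+ ε ℚ.≤ seq y n
x ≃ y = x ≤ y × y ≤ x

0ℝ : ℝ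
0ℝ = record { seq = const 0ℚ ; cauchy = λ ε 0<ε → 0 , λ _ _ _ _ → 0<ε }

_+_ : Op₂ ℝ
x + y = record { seq = λ n → seq x n ℚ.+ seq y n ; cauchy = cau }
  where
  interchange : ∀ a b c d →
    (a ℚ.+ b) ℚ.- (c ℚ.+ d) ≡ (a ℚ.- c) ℚ.+ (b ℚ.- d)
  interchange = solve 4
    (λ a b c d → (a :+ b) :- (c :+ d) := (a :- c) :+ (b :- d)) refl
    where open +-*-Solver

  cau : ∀ ε → 0ℚ ℚ.< ε → ∃ λ N → ∀ m n → N ℕ.≤ m → N ℕ.≤ n →
        ∣ (seq x m ℚ.+ seq y m) ℚ.- (seq x n ℚ.+ seq y n) ∣ ℚ.< ε
  cau ε 0<ε with cauchy x _ (halve 0<ε) | cauchy y _ (halve 0<ε)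
  ... | M , p | N , q = M ⊔ N , λ m n m≥ n≥ → begin-strict
    ∣ (seq x m ℚ.+ seq y m) ℚ.- (seq x n ℚ.+ seq y n) ∣
      ≡⟨ cong ∣_∣ (interchange (seq x m) (seq y m) (seq x n) (seq y n)) ⟩
    ∣ (seq x m ℚ.- seq x n) ℚ.+ (seq y m ℚ.- seq y n) ∣
      ≤⟨ ℚ.∣p+q∣≤∣p∣+∣q∣ (seq x m ℚ.- seq x n) (seq y m ℚ.- seq y n) ⟩
    ∣ seq x m ℚ.- seq x n ∣ ℚ.+ ∣ seq y m ℚ.- seq y n ∣
      <⟨ ℚ.+-mono-< (p m n (ℕ.m⊔n≤o⇒m≤o M N m≥) (ℕ.m⊔n≤o⇒m≤o M N n≥))
                    (q m n (ℕ.m⊔n≤o⇒n≤o M N m≥) (ℕ.m⊔n≤o⇒n≤o M N n≥)) ⟩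
    ½ ℚ.* ε ℚ.+ ½ ℚ.* ε
      ≡⟨ halves ε ⟩
    ε ∎
    where open ℚ.≤-Reasoning

≤-refl : ∀ {x} → x ≤ x
≤-refl {x} ε 0<ε = 0 , λ n _ →
  subst (ℚ._≤ seq x n ℚ.+ ε) (ℚ.+-identityʳ (seq x n))
        (ℚ.+-monoʳ-≤ (seq x n) (ℚ.<⇒≤ 0<ε))

≤-trans : ∀ {x y z} → x ≤ y → y ≤ z → x ≤ z
≤-trans {x} {y} {z} x≤y y≤z ε 0<ε
  with x≤y _ (halve 0<ε) | y≤z _ (halve 0<ε)
... | M , p | N , q = M ⊔ N , λ n n≥ → begin
  seq x n
    ≤⟨ p n (ℕ.m⊔n≤o⇒m≤o M N n≥) ⟩
  seq y n ℚ.+ ½ ℚ.* ε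
    ≤⟨ ℚ.+-monoˡ-≤ (½ ℚ.* ε) (q n (ℕ.m⊔n≤o⇒n≤o M N n≥)) ⟩
  (seq z n ℚ.+ ½ ℚ.* ε) ℚ.+ ½ ℚ.* ε
    ≡⟨ ℚ.+-assoc (seq z n) _ _ ⟩
  seq z n ℚ.+ (½ ℚ.* ε ℚ.+ ½ ℚ.* ε)
    ≡⟨ cong (seq z n ℚ.+_) (halves ε) ⟩
  seq z n ℚ.+ ε ∎
  where open ℚ.≤-Reasoning

≤-isPartialOrder : IsPartialOrder _≃_ _≤_
≤-isPartialOrder = record
  { isPreorder = record
    { isEquivalence = record
      { refl  = λ {x} → ≤-refl {x} , ≤-refl {x}
      ; sym   = λ (p , q) → q , p
      ; trans = λ {x} {y} {z} (p , q) (r , s) →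
                  ≤-trans {x} {y} {z} p r , ≤-trans {z} {y} {x} s q
      }
    ; reflexive = proj₁
    ; trans     = λ {x} {y} {z} → ≤-trans {x} {y} {z}
    }
  ; antisym = _,_
  }

-- Points are identified up to _≈_, so distinct points are those at
-- distance ≄ 0 and a subset must respect _≈_ (see Compact).
record MetricSpace : Set₁ where
  infix 4 _≈_
  field
    Carrier  : Set
    _≈_      : Rel Carrier 0ℓ
    d        : Carrier → Carrier → ℝ
    isMetric : IsGeneralMetric _≈_ _≃_ _≤_ 0ℝ _+_ d

module _ (K : MetricSpace) where
  open MetricSpace K

  ball : Carrier → ℝ → Pred Carrier 0ℓ
  ball x ε y = d x y < ε

  Open : Pred (Pred Carrier 0ℓ) 0ℓ
  Open O = ∀ {x} → x ∈ O → ∃ λ ε → 0ℝ < ε × ball x ε ⊆ O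

  closure : Pred Carrier 0ℓ → Pred Carrier 0ℓ
  closure S x = ∀ ε → 0ℝ < ε → ∃ λ y → y ∈ S × y ∈ ball x ε

  Dense : Pred (Pred Carrier 0ℓ) 0ℓ
  Dense S = ∀ x → x ∈ closure S

  Compact : Pred (Pred Carrier 0ℓ) (suc 0ℓ)
  Compact S = S Respects _≈_ ×
    (∀ {I : Set} (O : I → Pred Carrier 0ℓ) → (∀ i → Open (O i)) → S ⊆ ⋃ I O →
     ∃ λ (is : List I) → ∀ {x} → x ∈ S → Any (λ i → x ∈ O i) is)

  -- As with ideals on ω, singletons are required to be members. Without
  -- this, the compact subsets of ω in the one-point compactification of ω
  -- would represent Fin, which has the Ramsey property.
  record σIdeal : Set₁ where
    field
      Mem       : Pred (Pred Carrier 0ℓ) 0ℓ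
      compact   : ∀ {S} → S ∈ Mem → Compact S
      downward  : ∀ {S S′} → S′ ⊆ S → Compact S′ → S ∈ Mem → S′ ∈ Mem
      union     : ∀ {S} (Sₙ : ℕ → Pred Carrier 0ℓ) → (∀ n → Sₙ n ∈ Mem) →
                  Compact S → S ≐ ⋃ ℕ Sₙ → S ∈ Mem
      singleton : ∀ x → (_≈ x) ∈ Mem

  image : (ℕ → Carrier) → 𝒫ω → Pred Carrier 0ℓ
  image e A x = ∃ λ n → n ∈ El A × e n ≈ x

record TopologicallyRepresented (J : Ideal) : Set₁ where
  field
    K : MetricSpace

  open MetricSpace K

  field
    K-compact  : Compact K U
    D          : Pred Carrier 0ℓ
    D-dense    : Dense K D
    e          : ℕ → Carrier
    e-in-D     : ∀ n → e n ∈ D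
    e-inj      : Injective _≡_ _≈_ e
    e-onto-D   : ∀ {x} → x ∈ D → ∃ λ n → e n ≈ x
    𝒦          : σIdeal K
    represents : ∀ A → A ∈ Mem J ⇔ closure K (image K e A) ∈ σIdeal.Mem 𝒦

{-# OPTIONS --safe #-}
module Submission where

-- Colouring pairs by the lexicographic order of f : ω → 2^ω makes f converge along every homogeneous
-- set. Hence, if J has the Ramsey property, any sequence (cₙ) of colourings has a single J-positive
-- set that is homogeneous for every cₙ up to finitely many points: thin out first so that all
-- columns y ↦ cₙ(x, y) converge, then so that their limits converge in x, and finally so that each
-- y is beyond the moduli of convergence of the smaller x. If cₙ witnesses that Iₙ fails the ordinary
-- Ramsey property, such a set lies in every Iₙ, so J is not ⋂ Iₙ.
--
-- For a tall analytic P-ideal I = f[ω^ω], call Q ⊆ ω^ω cofinal if f[Q] is ⊆*-cofinal in I. Since I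
-- is a P-ideal, a cofinal set is not a countable union of non-cofinal ones; since I is tall, almost
-- every n is such that { y ∈ Q | n ∈ f y } is still cofinal. Fusing such refinements gives a
-- function h such that all sets with gaps at least h lie in I, and "the gap is at least h" is a
-- colouring without positive homogeneous sets.
--
-- If J is represented in K, the lexicographic colouring of the distances to the dense sequence e
-- has homogeneous sets along which e converges in K; the closure of a convergent sequence is a
-- countable union of singletons, hence in the σ-ideal.

open import Defs
open import Axiom.ExcludedMiddle using (ExcludedMiddle)
open import Data.Bool.Base using (Bool; true; false; T; not; if_then_else_)
open import Data.Bool.Properties using (T-∧; T-∨; T-≡; ¬-not)
open import Data.Empty using (⊥-elim)
open import Data.List.Base using (List; []; _∷_; _++_; map; upTo)
open import Data.List.Extrema.Nat using (max; xs≤max)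
open import Data.List.Membership.Propositional using (find; lose) renaming (_∈_ to _∈ˡ_)
open import Data.List.Membership.Propositional.Properties
  using (∈-map⁺; ∈-upTo⁺; ∈-++⁺ˡ; ∈-++⁺ʳ)
import Data.List.Relation.Unary.All as All
open import Data.List.Relation.Unary.Any using (here; there)
open import Data.Integer.Base as ℤ using ()
open import Data.Nat.Base as ℕ using (ℕ; suc; _⊔_)
open import Data.Nat.Coprimality using (1-coprimeTo)
import Data.Nat.Properties as ℕ
open import Data.Product.Base using (_×_; _,_; ∃; ∃₂; proj₁; proj₂)
open import Data.Rational.Base as ℚ using (ℚ; mkℚ; 0ℚ; ½; ∣_∣)
import Data.Rational.Properties as ℚ
open import Data.Sum.Base using (_⊎_; inj₁; inj₂)
open import Function.Base using (_∘_; id; const; case_of_)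
open import Function.Bundles using (_⇔_; Equivalence)
open import Function.Metric.Structures using (IsGeneralMetric)
open import Level using (0ℓ)
open import Relation.Binary.Definitions using (tri<; tri≈; tri>)
open import Relation.Binary.PropositionalEquality
  using (_≡_; _≗_; refl; sym; trans; cong; subst)
open import Relation.Nullary.Decidable using (Dec; yes; no; does; decidable-stable; dec-true)
open import Relation.Nullary.Negation using (¬_; contradiction)
open import Relation.Unary using (Pred; _∈_; _∉_; _⊆_; _∩_; ⋃; U)

-- List maxima, enumeration of pairs, finite sets of naturals.

maxOn : ∀ {a} {X : Set a} → (X → ℕ) → List X → ℕ
maxOn h xs = max 0 (map h xs)

≤-maxOn : ∀ {a} {X : Set a} (h : X → ℕ) {xs x} → x ∈ˡ xs → h x ℕ.≤ maxOn h xs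
≤-maxOn h x∈xs = All.lookup (xs≤max 0 _) (∈-map⁺ h x∈xs)

Agree-suc : ∀ {X : Set} {k} {x y : ℕ → X} → Agree k x y → x k ≡ y k → Agree (suc k) x y
Agree-suc p q i i<1+k with ℕ.m<1+n⇒m<n∨m≡n i<1+k
... | inj₁ i<k  = p i i<k
... | inj₂ refl = q

-- One step of Cantor's walk along the antidiagonals, each entered at its point with second
-- coordinate 0.
next : ℕ × ℕ → ℕ × ℕ
next (ℕ.zero , n) = suc n , 0
next (suc m  , n) = m , suc n

unpair : ℕ → ℕ × ℕ
unpair ℕ.zero  = 0 , 0
unpair (suc k) = next (unpair k)

unpair-diagonal : ∀ m n → (∃ λ k → unpair k ≡ (m ℕ.+ n , 0)) → ∃ λ k → unpair k ≡ (m , n)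
unpair-diagonal m ℕ.zero (k , p) = k , trans p (cong (_, 0) (ℕ.+-identityʳ m))
unpair-diagonal m (suc n) (k , p)
  with l , q ← unpair-diagonal (suc m) n (k , trans p (cong (_, 0) (ℕ.+-suc m n))) =
  suc l , cong next q

unpair-corner : ∀ m → ∃ λ k → unpair k ≡ (m , 0)
unpair-corner ℕ.zero = 0 , refl
unpair-corner (suc m) with k , p ← unpair-diagonal 0 m (unpair-corner m) = suc k , cong next p

unpair-surjective : ∀ m n → ∃ λ k → unpair k ≡ (m , n)
unpair-surjective m n = unpair-diagonal m n (unpair-corner (m ℕ.+ n))

∖⁺ : ∀ A B {n} → n ∈ El A → n ∉ El B → n ∈ El (A ∖ B)
∖⁺ A B {n} n∈A n∉B with B n
... | true  = contradiction _ n∉B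
... | false = Equivalence.from T-∧ (n∈A , _)

∖⁻ : ∀ A B {n} → n ∈ El (A ∖ B) → n ∈ El A × n ∉ El B
∖⁻ A B {n} p with A n | B n
... | true | false = _ , id

Bounded : Pred 𝒫ω 0ℓ
Bounded A = ∃ λ N → ∀ {n} → n ∈ El A → n ℕ.< N

finite⇒bounded : ∀ A → Finite A → Bounded A
finite⇒bounded A (xs , A⊆xs) = suc (maxOn id xs) , λ n∈A → ℕ.s≤s (≤-maxOn id (A⊆xs n∈A))

bounded⇒finite : ∀ A → Bounded A → Finite A
bounded⇒finite A (N , A<N) = upTo N , ∈-upTo⁺ ∘ A<N

infix 4 _⊑*_

_⊑*_ : 𝒫ω → 𝒫ω → Set
A ⊑* B = Finite (A ∖ B)

⊑*-beyond : ∀ A B N → (∀ {n} → N ℕ.≤ n → n ∈ El A → n ∈ El B) → A ⊑* B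
⊑*-beyond A B N A⊆B = bounded⇒finite (A ∖ B) (N , λ p → let n∈A , n∉B = ∖⁻ A B p in
  ℕ.≰⇒> λ N≤n → n∉B (A⊆B N≤n n∈A))

-- Rational bounds on reals.

radius : ℕ → ℚ
-- The fraction 1/(k+1): `mkℚ` stores the denominator minus one.
radius k = mkℚ (ℤ.+ 1) k (1-coprimeTo (suc k))

0<radius : ∀ k → 0ℚ ℚ.< radius k
0<radius k = ℚ.*<* (ℤ.+<+ (ℕ.s≤s ℕ.z≤n))

radius-antitone : ∀ {k l} → k ℕ.≤ l → radius l ℚ.≤ radius k
radius-antitone k≤l = ℚ.*≤* (ℤ.+≤+ (ℕ.+-monoˡ-≤ 0 (ℕ.s≤s k≤l)))

radius-small : ∀ {ε} → 0ℚ ℚ.< ε → ∃ λ k → radius k ℚ.≤ ε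
radius-small {mkℚ (ℤ.+ 0) q _} (ℚ.*<* (ℤ.+<+ ()))
radius-small {mkℚ (ℤ.+ suc p) q _} _ =
  q , ℚ.*≤* (ℤ.+≤+ (ℕ.*-monoˡ-≤ (suc q) (ℕ.s≤s (ℕ.z≤n {p}))))
radius-small {mkℚ ℤ.-[1+ p ] q _} (ℚ.*<* ())

p≤p+ε : ∀ p {ε} → 0ℚ ℚ.< ε → p ℚ.≤ p ℚ.+ ε
p≤p+ε p {ε} 0<ε = subst (ℚ._≤ p ℚ.+ ε) (ℚ.+-identityʳ p) (ℚ.+-monoʳ-≤ p (ℚ.<⇒≤ 0<ε))

constant : ℚ → ℝ
constant ε = record
  { seq = const ε
  ; cauchy = λ δ 0<δ → 0 , λ _ _ _ _ → subst (λ p → ∣ p ∣ ℚ.< δ) (sym (ℚ.+-inverseʳ ε)) 0<δ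
  }

infix 4 _≼_

-- Unlike `_≤_`, this bound leaves no room for slack, so bounds on sums add up exactly.
_≼_ : ℝ → ℚ → Set
x ≼ ε = ∃ λ N → ∀ n → N ℕ.≤ n → ℝ.seq x n ℚ.≤ ε

≼-mono : ∀ x {ε δ} → ε ℚ.≤ δ → x ≼ ε → x ≼ δ
≼-mono x ε≤δ (N , p) = N , λ n N≤n → ℚ.≤-trans (p n N≤n) ε≤δ

≤-≼-trans : ∀ x y {ε δ} → 0ℚ ℚ.< δ → x ≤ y → y ≼ ε → x ≼ ε ℚ.+ δ
≤-≼-trans x y {ε} {δ} 0<δ x≤y (N , q) with M , p ← x≤y δ 0<δ =
  M ⊔ N , λ n n≥ → ℚ.≤-trans (p n (ℕ.m⊔n≤o⇒m≤o M N n≥))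
                             (ℚ.+-monoˡ-≤ δ (q n (ℕ.m⊔n≤o⇒n≤o M N n≥)))

+-≼ : ∀ x y {ε δ} → x ≼ ε → y ≼ δ → x + y ≼ ε ℚ.+ δ
+-≼ x y (M , p) (N , q) =
  M ⊔ N , λ n n≥ → ℚ.+-mono-≤ (p n (ℕ.m⊔n≤o⇒m≤o M N n≥)) (q n (ℕ.m⊔n≤o⇒n≤o M N n≥))

<⇒≼ : ∀ x {ε} → x < constant ε → x ≼ ε
<⇒≼ x (δ , 0<δ , N , p) = N , λ n N≤n → ℚ.≤-trans (p≤p+ε _ 0<δ) (p n N≤n)

0<constant : ∀ {ε} → 0ℚ ℚ.< ε → 0ℝ < constant ε
0<constant {ε} 0<ε = ε , 0<ε , 0 , λ _ _ → ℚ.≤-reflexive (ℚ.+-identityˡ ε)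

≼⇒< : ∀ {e} → 0ℝ < e → ∃ λ k → ∀ x → x ≼ radius k → x < e
≼⇒< {e} (δ , 0<δ , M , p) with k , r≤ ← radius-small (halve 0<δ) =
  k , λ x (N , q) → ½ ℚ.* δ , halve 0<δ , M ⊔ N , λ n n≥ → begin
    ℝ.seq x n ℚ.+ ½ ℚ.* δ
      ≤⟨ ℚ.+-monoˡ-≤ (½ ℚ.* δ) (ℚ.≤-trans (q n (ℕ.m⊔n≤o⇒n≤o M N n≥)) r≤) ⟩
    ½ ℚ.* δ ℚ.+ ½ ℚ.* δ  ≡⟨ halves δ ⟩
    δ                    ≡⟨ ℚ.+-identityˡ δ ⟨
    0ℚ ℚ.+ δ             ≤⟨ p n (ℕ.m⊔n≤o⇒m≤o M N n≥) ⟩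
    ℝ.seq e n            ∎
  where open ℚ.≤-Reasoning

≼-zero : ∀ x → (∀ k → x ≼ radius k) → x ≤ 0ℝ
≼-zero x p ε 0<ε with k , r≤ ← radius-small 0<ε with N , q ← p k =
  N , λ n N≤n → ℚ.≤-trans (q n N≤n) (ℚ.≤-trans r≤ (ℚ.≤-reflexive (sym (ℚ.+-identityˡ ε))))

-- Classical logic and inclusion modulo finite sets.

module Classical (em : ExcludedMiddle 0ℓ) where

  dne : ∀ {P : Set} → ¬ ¬ P → P
  dne = decidable-stable em

  ¬∀⇒∃¬ : ∀ {X : Set} {P : X → Set} → ¬ (∀ x → P x) → ∃ λ x → ¬ P x
  ¬∀⇒∃¬ ¬∀ = dne λ ¬∃ → ¬∀ λ x → dne λ ¬p → ¬∃ (x , ¬p)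

  ⟦_⟧ : Pred ℕ 0ℓ → 𝒫ω
  ⟦ P ⟧ n = does (em {P n})

  ⟦⟧⁺ : ∀ (P : Pred ℕ 0ℓ) {n} → P n → n ∈ El ⟦ P ⟧
  ⟦⟧⁺ P {n} p with em {P n}
  ... | yes _ = _
  ... | no ¬p = ¬p p

  ⟦⟧⁻ : ∀ (P : Pred ℕ 0ℓ) {n} → n ∈ El ⟦ P ⟧ → P n
  ⟦⟧⁻ P {n} _ with em {P n}
  ... | yes p = p

  ⊑*-bound : ∀ A B → A ⊑* B → ∃ λ N → ∀ {n} → N ℕ.≤ n → n ∈ El A → n ∈ El B
  ⊑*-bound A B A⊑*B with N , p ← finite⇒bounded (A ∖ B) A⊑*B =
    N , λ N≤n n∈A → dne λ n∉B → ℕ.<⇒≱ (p (∖⁺ A B n∈A n∉B)) N≤n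

  ⊑*-trans : ∀ A B C → A ⊑* B → B ⊑* C → A ⊑* C
  ⊑*-trans A B C A⊑*B B⊑*C with M , p ← ⊑*-bound A B A⊑*B | N , q ← ⊑*-bound B C B⊑*C =
    ⊑*-beyond A C (M ⊔ N) λ n≥ n∈A → q (ℕ.m⊔n≤o⇒n≤o M N n≥) (p (ℕ.m⊔n≤o⇒m≤o M N n≥) n∈A)

  infinite⇒unbounded : ∀ A → Infinite A → ∀ N → ∃ λ n → N ℕ.≤ n × n ∈ El A
  infinite⇒unbounded A inf N = dne λ ¬∃ → inf (bounded⇒finite A
    (N , λ {n} n∈A → ℕ.≰⇒> λ N≤n → ¬∃ (n , N≤n , n∈A)))

  module _ (I : Ideal) where
    open Ideal I using (downward; union; finite)

    ⊑*-downward : ∀ A B → A ⊑* B → B ∈ Mem I → A ∈ Mem I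
    ⊑*-downward A B A⊑*B B∈I = downward A⊑ (union (finite A⊑*B) B∈I)
      where
      A⊑ : A ⊑ (A ∖ B) ∪ B
      A⊑ {n} n∈A with em {n ∈ El B}
      ... | yes n∈B = Equivalence.from T-∨ (inj₂ n∈B)
      ... | no  n∉B = Equivalence.from T-∨ (inj₁ (∖⁺ A B n∈A n∉B))

    Small-homogeneous : Colouring ω → Set
    Small-homogeneous c =
      ∀ Y (Y⊑ω : Y ⊑ ω) → Homogeneous {ω} {Y} c (λ {n} → Y⊑ω {n}) → Y ∈ Mem I

    ¬ordinary⇒colouring : ¬ OrdinaryRamsey I → ∃ Small-homogeneous
    ¬ordinary⇒colouring ¬R with c , p ← ¬∀⇒∃¬ ¬R =
      c , λ Y Y⊑ω hom → dne λ Y∉ → p (Y , Y⊑ω , Y∉ , hom)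

    colouring⇒¬ordinary : ∀ c → Small-homogeneous c → ¬ OrdinaryRamsey I
    colouring⇒¬ordinary c p R with Y , Y⊑ω , Y∉ , hom ← R c = Y∉ (p Y Y⊑ω hom)

  -- Lexicographic and gap colourings.

  HomogeneousFor : (ℕ → ℕ → Bool) → 𝒫ω → Bool → Set
  HomogeneousFor c Y i = ∀ m n → m ∈ El Y → n ∈ El Y → m ℕ.< n → c m n ≡ i

  lex : (ℕ → ℕ → Bool) → ℕ → ℕ → Bool
  lex f m n = does (em {∃ λ k → Agree k (f m) (f n) × f m k ≡ false × f n k ≡ true})

  Convergent : (ℕ → ℕ → Bool) → 𝒫ω → Set
  Convergent f Y = ∀ k → ∃₂ λ b N → ∀ {n} → N ℕ.≤ n → n ∈ El Y → f n k ≡ b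

  -- A lexicographically increasing pair first differs by a rise, so a `true` after equal values
  -- persists; a pair that does not increase cannot first differ by a rise, so a `false` persists.
  lex-step : ∀ f i m n k → lex f m n ≡ i → Agree k (f m) (f n) → f m k ≡ i → f n k ≡ i
  lex-step f i m n k l≡i ag fmk
    with em {∃ λ k → Agree k (f m) (f n) × f m k ≡ false × f n k ≡ true}
  lex-step f true m n k _ ag fmk | yes (j , ag′ , fmj , fnj) with ℕ.<-cmp j k
  ... | tri< j<k _ _ = contradiction (trans (sym fmj) (trans (ag j j<k) fnj)) λ ()
  ... | tri≈ _ refl _ = contradiction (trans (sym fmj) fmk) λ ()
  ... | tri> _ _ k<j = trans (sym (ag′ k k<j)) fmk
  lex-step f false m n k _ ag fmk | no ¬p with f n k in fnk
  ... | false = refl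
  ... | true  = contradiction (k , ag , fmk , fnk) ¬p

  module _ (f : ℕ → ℕ → Bool) (Y : 𝒫ω) (i : Bool) (hom : HomogeneousFor (lex f) Y i) where

    -- Past the point where the first k values are fixed, lex-step makes i absorbing at k.
    lex-constant : ∀ k N → (∀ {m n} → N ℕ.≤ m → N ℕ.≤ n → m ∈ El Y → n ∈ El Y →
                   Agree k (f m) (f n)) →
                   ∃₂ λ b N → ∀ {n} → N ℕ.≤ n → n ∈ El Y → f n k ≡ b
    lex-constant k N ag with em {∃ λ m → N ℕ.≤ m × m ∈ El Y × f m k ≡ i}
    ... | yes (m , N≤m , m∈Y , fmk) = i , suc m , λ {n} m<n n∈Y →
      lex-step f i m n k (hom m n m∈Y n∈Y m<n)
        (ag N≤m (ℕ.≤-trans N≤m (ℕ.<⇒≤ m<n)) m∈Y n∈Y) fmk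
    ... | no ¬∃ = not i , N , λ N≤n n∈Y → ¬-not λ fnk → ¬∃ (_ , N≤n , n∈Y , fnk)

    lex-agree : ∀ k → ∃ λ N → ∀ {m n} → N ℕ.≤ m → N ℕ.≤ n → m ∈ El Y → n ∈ El Y →
                Agree k (f m) (f n)
    lex-agree ℕ.zero = 0 , λ _ _ _ _ _ ()
    lex-agree (suc k) with M , p ← lex-agree k with b , N , q ← lex-constant k M p =
      M ⊔ N , λ m≥ n≥ m∈Y n∈Y →
        Agree-suc (p (ℕ.m⊔n≤o⇒m≤o M N m≥) (ℕ.m⊔n≤o⇒m≤o M N n≥) m∈Y n∈Y)
          (trans (q (ℕ.m⊔n≤o⇒n≤o M N m≥) m∈Y) (sym (q (ℕ.m⊔n≤o⇒n≤o M N n≥) n∈Y)))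

    lex-convergent : Convergent f Y
    lex-convergent k = let N , p = lex-agree k in lex-constant k N p

  sparse : (ℕ → ℕ) → ℕ → ℕ → Bool
  sparse h m n = does (em {h m ℕ.≤ n})

  Sparse : (ℕ → ℕ) → 𝒫ω → Set
  Sparse h Y = ∀ {m n} → m ∈ El Y → n ∈ El Y → m ℕ.< n → h m ℕ.≤ n

  does-true : ∀ {P : Set} (p? : Dec P) → does p? ≡ true → P
  does-true (yes p) _ = p

  does-false : ∀ {P : Set} (p? : Dec P) → does p? ≡ false → ¬ P
  does-false (no ¬p) _ = ¬p

  -- Colour `false` would put every later element below `h m`, and so bound `Y`.
  sparse-homogeneous : ∀ h Y i → HomogeneousFor (sparse h) Y i → Infinite Y → Sparse h Y
  sparse-homogeneous h Y true hom _ m∈Y n∈Y m<n = does-true em (hom _ _ m∈Y n∈Y m<n)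
  sparse-homogeneous h Y false hom inf
    with m , _ , m∈Y ← infinite⇒unbounded Y inf 0
    with n , n≥ , n∈Y ← infinite⇒unbounded Y inf (suc m ⊔ h m) =
    contradiction (ℕ.m⊔n≤o⇒n≤o (suc m) (h m) n≥)
      (does-false em (hom m n m∈Y n∈Y (ℕ.m⊔n≤o⇒m≤o (suc m) (h m) n≥)))

  -- Countably many colourings under the Ramsey property.

  module _ {J : Ideal} (R : Ramsey J) where

    positive⇒infinite : ∀ Y → Y ∈ J ⁺ → Infinite Y
    positive⇒infinite Y Y∈⁺ fin = Y∈⁺ (Ideal.finite J fin)

    ramsey-convergent : ∀ Y → Y ∈ J ⁺ → ∀ f → ∃ λ Z → Z ⊑ Y × Z ∈ J ⁺ × Convergent f Z
    ramsey-convergent Y Y⁺ f with Z , Z⊑Y , Z⁺ , i , hom ← R Y Y⁺ (λ m n _ _ _ → lex f m n) =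
      Z , (λ {_} → Z⊑Y) , Z⁺ , lex-convergent f Z i hom

    ramsey-sparse : ∀ Y → Y ∈ J ⁺ → ∀ h → ∃ λ Z → Z ⊑ Y × Z ∈ J ⁺ × Sparse h Z
    ramsey-sparse Y Y⁺ h with Z , Z⊑Y , Z⁺ , i , hom ← R Y Y⁺ (λ m n _ _ _ → sparse h m n) =
      Z , (λ {_} → Z⊑Y) , Z⁺ , λ {_} → sparse-homogeneous h Z i hom (positive⇒infinite Z Z⁺)

    module _ (c : ℕ → ℕ → ℕ → Bool) where

      -- For fixed `y`, the bits `c n x y` over all `n` and `x` form one point of Cantor space, so a
      -- single lexicographic colouring settles every column at once.
      ramsey-columns : ∃ λ Y → Y ∈ J ⁺ ×
        ∀ n x → ∃₂ λ b N → ∀ {y} → N ℕ.≤ y → y ∈ El Y → c n x y ≡ b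
      ramsey-columns
        with Y , _ , Y⁺ , conv ← ramsey-convergent ω (Ideal.proper J)
                                   (λ y k → let n , x = unpair k in c n x y) =
        Y , Y⁺ , λ n x →
          let k , k↦nx = unpair-surjective n x
              b , N , const-b = conv k
          in b , N , λ {y} N≤y y∈Y →
               trans (cong (λ (n , x) → c n x y) (sym k↦nx)) (const-b N≤y y∈Y)

      ramsey-all : ∃ λ Z → Z ∈ J ⁺ × ∀ n → ∃₂ λ b N →
        ∀ x y → N ℕ.≤ x → x ∈ El Z → y ∈ El Z → x ℕ.< y → c n x y ≡ b
      ramsey-all
        with Y , Y⁺ , limits ← ramsey-columns
        with Y′ , Y′⊑Y , Y′⁺ , conv ← ramsey-convergent Y Y⁺ (λ x n → proj₁ (limits n x))
        with Z , Z⊑Y′ , Z⁺ , thin ← ramsey-sparse Y′ Y′⁺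
               -- Only the `n` below `x` are covered, as one gap can exceed only finitely many
               -- moduli; `suc n` in the bound below ensures that `n` is among them.
               (λ x → maxOn (λ n → proj₁ (proj₂ (limits n x))) (upTo x)) =
        Z , Z⁺ , λ n → let b , N , const-b = conv n in
          b , suc n ⊔ N , λ x y x≥ x∈Z y∈Z x<y → trans
            (proj₂ (proj₂ (limits n x))
              (ℕ.≤-trans (≤-maxOn (λ n → proj₁ (proj₂ (limits n x)))
                                  (∈-upTo⁺ (ℕ.m⊔n≤o⇒m≤o (suc n) N x≥)))
                         (thin x∈Z y∈Z x<y))
              (Y′⊑Y (Z⊑Y′ y∈Z)))
            (const-b (ℕ.m⊔n≤o⇒n≤o (suc n) N x≥) (Z⊑Y′ x∈Z))

  -- The value for y ≤ x is junk.
  total : Colouring ω → ℕ → ℕ → Bool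
  total c x y with x ℕ.<? y
  ... | yes x<y = c x y _ _ x<y
  ... | no  _   = false

  total-< : ∀ c {x y} (x<y : x ℕ.< y) → c x y _ _ x<y ≡ total c x y
  total-< c {x} {y} x<y with x ℕ.<? y
  ... | yes p   = cong (c x y _ _) (ℕ.<-irrelevant x<y p)
  ... | no  x≮y = contradiction x<y x≮y

  module _ (I : Ideal) (c : Colouring ω) (small : Small-homogeneous I c) where

    almost-homogeneous-∈ : ∀ Z b N →
      (∀ x y → N ℕ.≤ x → x ∈ El Z → y ∈ El Z → x ℕ.< y → total c x y ≡ b) → Z ∈ Mem I
    almost-homogeneous-∈ Z b N hom = ⊑*-downward I Z ⟦ Late ⟧
      (⊑*-beyond Z ⟦ Late ⟧ N λ N≤n n∈Z → ⟦⟧⁺ Late (N≤n , n∈Z))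
      (small ⟦ Late ⟧ _ (b , λ x y x∈ y∈ x<y →
        let N≤x , x∈Z = ⟦⟧⁻ Late x∈
            _   , y∈Z = ⟦⟧⁻ Late y∈
        in trans (total-< c x<y) (hom x y N≤x x∈Z y∈Z x<y)))
      where
      Late : Pred ℕ 0ℓ
      Late x = N ℕ.≤ x × x ∈ El Z

  ⋂-¬ramsey : (I : ℕ → Ideal) → (∀ n → ¬ OrdinaryRamsey (I n)) → ¬ Ramsey (⋂ᴵ I)
  ⋂-¬ramsey I ¬R R =
    let bad n = ¬ordinary⇒colouring (I n) (¬R n)
        Z , Z⁺ , hom = ramsey-all {⋂ᴵ I} R (total ∘ proj₁ ∘ bad)
    in Z⁺ λ n → let b , N , hom-b = hom n in
         almost-homogeneous-∈ (I n) (proj₁ (bad n)) (proj₂ (bad n)) Z b N hom-b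

  -- Tall analytic P-ideals.

  module _ (I : Ideal) (tall : Tall I) (pIdeal : PIdeal I)
           (f : (ℕ → ℕ) → 𝒫ω) (f-continuous : Continuous f)
           (range : ∀ A → A ∈ Mem I ⇔ (∃ λ x → f x ≗ A)) where
    open Ideal I using (union; finite)

    private
      Cofinal : Pred (Pred (ℕ → ℕ) 0ℓ) 0ℓ
      Cofinal Q = ∀ A → A ∈ Mem I → ∃ λ y → y ∈ Q × A ⊑* f y

      ∅∈I : const false ∈ Mem I
      ∅∈I = finite ([] , λ ())

    cofinal-mono : ∀ {P Q} → P ⊆ Q → Cofinal P → Cofinal Q
    cofinal-mono P⊆Q cof A A∈I with y , y∈P , A⊑ ← cof A A∈I = y , P⊆Q y∈P , A⊑

    private
      -- Asked of every `P`, with the empty set as default for cofinal ones, so that sets `P n`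
      -- yield a full sequence of witnesses to which `pIdeal` applies.
      non-cofinal-witness : (P : Pred (ℕ → ℕ) 0ℓ) →
        ∃ λ A → A ∈ Mem I × (¬ Cofinal P → ∀ {y} → A ⊑* f y → y ∉ P)
      non-cofinal-witness P with em {Cofinal P}
      ... | yes cof = const false , ∅∈I , contradiction cof
      ... | no ¬cof with A , ¬A ← ¬∀⇒∃¬ ¬cof =
        A , dne (λ A∉I → ¬A (⊥-elim ∘ A∉I)) , λ _ {y} A⊑ y∈P → ¬A λ _ → y , y∈P , A⊑

    -- Take A almost containing a witness for every P n that is not cofinal.
    cofinal-pieces : (P : ℕ → Pred (ℕ → ℕ) 0ℓ) → ∃ λ A → A ∈ Mem I ×
      (∀ {y} → A ⊑* f y → ∀ {n} → y ∈ P n → Cofinal (P n))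
    cofinal-pieces P
      with B , B∈I , W⊑B ← pIdeal (λ n → proj₁ (non-cofinal-witness (P n)))
                                  (λ n → proj₁ (proj₂ (non-cofinal-witness (P n)))) =
      B , B∈I , λ {y} B⊑ {n} y∈P → dne λ ¬cof →
        let A , _ , avoids = non-cofinal-witness (P n)
        in avoids ¬cof (⊑*-trans A B (f y) (W⊑B n) B⊑) y∈P

    -- If infinitely many `n` failed, tallness would put an infinite set `B` of them into `I`. Some
    -- `y` in `Q` then almost contains both `B` and the set `A` of `cofinal-pieces`, so it lies in
    -- the piece of some failing `n`, making that piece cofinal.
    cofinal-threshold : ∀ Q → Cofinal Q →
      ∃ λ N → ∀ n → N ℕ.≤ n → Cofinal (Q ∩ (λ y → n ∈ El (f y)))
    cofinal-threshold Q cof = helper em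
      where
      P : ℕ → Pred (ℕ → ℕ) 0ℓ
      P n = Q ∩ (λ y → n ∈ El (f y))

      Bad : Pred ℕ 0ℓ
      Bad n = ¬ Cofinal (P n)

      helper : Dec (Finite ⟦ Bad ⟧) → ∃ λ N → ∀ n → N ℕ.≤ n → Cofinal (P n)
      helper (yes fin) with N , W<N ← finite⇒bounded ⟦ Bad ⟧ fin =
        N , λ n N≤n → dne λ ¬cof → ℕ.<⇒≱ (W<N (⟦⟧⁺ Bad ¬cof)) N≤n
      helper (no inf)
        with B , B⊑W , B-inf , B∈I ← tall ⟦ Bad ⟧ inf
        with A , A∈I , pieces ← cofinal-pieces P
        with y , y∈Q , xs , p ← cof (A ∪ B) (union A∈I B∈I)
        with N , B⊆fy ← ⊑*-bound B (f y) (xs , λ q → let n∈B , n∉fy = ∖⁻ B (f y) q in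
                          p (∖⁺ (A ∪ B) (f y) (Equivalence.from T-∨ (inj₂ n∈B)) n∉fy))
        with n , N≤n , n∈B ← infinite⇒unbounded B B-inf N =
        ⊥-elim (⟦⟧⁻ Bad (B⊑W n∈B) (pieces
          (xs , λ q → let n∈A , n∉fy = ∖⁻ A (f y) q in
            p (∖⁺ (A ∪ B) (f y) (Equivalence.from T-∨ (inj₁ n∈A)) n∉fy))
          (y∈Q , B⊆fy N≤n n∈B)))

    -- Sorting by the value at the next coordinate gives countably many pieces, so one of them stays
    -- cofinal.
    cofinal-agree : ∀ Q → Cofinal Q → ∀ m → ∃ λ z → Cofinal (Q ∩ Agree m z)
    cofinal-agree Q cof ℕ.zero = const 0 , cofinal-mono (λ q → q , λ _ ()) cof
    cofinal-agree Q cof (suc m)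
      with z , cof′ ← cofinal-agree Q cof m
      with A , A∈I , pieces ← cofinal-pieces (λ i → (Q ∩ Agree m z) ∩ (λ y → y m ≡ i))
      with y , (y∈Q , zy) , A⊑ ← cof′ A A∈I =
      y , cofinal-mono (λ ((w∈Q , zw) , wm≡ym) → w∈Q , Agree-suc
                          (λ i i<m → trans (sym (zy i i<m)) (zw i i<m)) (sym wm≡ym))
                       (pieces A⊑ ((y∈Q , zy) , refl))

    private
      State : Set₁
      State = ∃ Cofinal

      threshold : State → ℕ
      threshold (Q , cof) = proj₁ (cofinal-threshold Q cof)

    -- The fusion step at `n`. Shared initial coordinates make a limit exist; when `n` is below the
    -- threshold only these are secured, so that the step is defined for all states and numbers.
    refine : (q : State) (n : ℕ) → ∃ λ (q′ : State) → proj₁ q′ ⊆ proj₁ q ×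
      (∀ {x y} → x ∈ proj₁ q′ → y ∈ proj₁ q′ → Agree n x y) ×
      (threshold q ℕ.≤ n → ∀ {y} → y ∈ proj₁ q′ → n ∈ El (f y))
    refine q@(Q , cof) n with em {threshold q ℕ.≤ n}
    ... | yes N≤n with z , cof′ ← cofinal-agree _ (proj₂ (cofinal-threshold Q cof) n N≤n) n =
      (_ , cof′) , proj₁ ∘ proj₁ ,
      (λ (_ , zx) (_ , zy) i i<n → trans (sym (zx i i<n)) (zy i i<n)) , λ _ → proj₂ ∘ proj₁
    ... | no N≰n with z , cof′ ← cofinal-agree Q cof n =
      (_ , cof′) , proj₁ ,
      (λ (_ , zx) (_ , zy) i i<n → trans (sym (zx i i<n)) (zy i i<n)) , λ N≤n → contradiction N≤n N≰n

    private
      step : ℕ → State → State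
      step n q = proj₁ (refine q n)

      -- Each number below the argument is processed or skipped, so all histories are listed. There
      -- are finitely many, which lets one function dominate their thresholds before any sparse set
      -- is given.
      reachable : ℕ → List State
      reachable ℕ.zero  = (U , λ A A∈I → let x , fx≗A = Equivalence.to (range A) A∈I in
        x , _ , [] , λ {n} p → let n∈A , n∉fx = ∖⁻ A (f x) p in
          contradiction (subst T (sym (fx≗A n)) n∈A) n∉fx) ∷ []
      reachable (suc n) = reachable n ++ map (step n) (reachable n)

      -- Dominates the thresholds of all states that arise from processing numbers up to n.
      gap : ℕ → ℕ
      gap n = maxOn threshold (reachable (suc n))

    module _ (Z : 𝒫ω) (Z-inf : Infinite Z) (Z-sparse : Sparse gap Z) where

      private
        run : ∀ m → ∃ λ q → q ∈ˡ reachable m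
        run ℕ.zero = _ , here refl
        run (suc m) with em {m ∈ El Z} | run m
        ... | yes _ | q , q∈ = step m q , ∈-++⁺ʳ (reachable m) (∈-map⁺ (step m) q∈)
        ... | no  _ | q , q∈ = q , ∈-++⁺ˡ q∈

        stage : ℕ → State
        stage m = proj₁ (run m)

        Stage : ℕ → Pred (ℕ → ℕ) 0ℓ
        Stage m = proj₁ (stage m)

        stage-∈ : ∀ {m} → m ∈ El Z → stage (suc m) ≡ step m (stage m)
        stage-∈ {m} m∈Z with em {m ∈ El Z}
        ... | yes _  = refl
        ... | no m∉Z = contradiction m∈Z m∉Z

        stage-⊆ : ∀ m → Stage (suc m) ⊆ Stage m
        stage-⊆ m with em {m ∈ El Z}
        ... | yes _ = proj₁ (proj₂ (refine (stage m) m))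
        ... | no  _ = id

        stage-antitone : ∀ {m n} → m ℕ.≤′ n → Stage n ⊆ Stage m
        stage-antitone ℕ.≤′-refl = id
        stage-antitone (ℕ.≤′-step m≤n) = stage-antitone m≤n ∘ stage-⊆ _

        stage-agree : ∀ {m n} → m ∈ El Z → m ℕ.< n →
                      ∀ {x y} → x ∈ Stage (suc m) → y ∈ Stage n → Agree m x y
        stage-agree {m} m∈Z m<n x∈ y∈ =
          proj₁ (proj₂ (proj₂ (refine (stage m) m)))
            (subst (λ q → _ ∈ proj₁ q) (stage-∈ m∈Z) x∈)
            (subst (λ q → _ ∈ proj₁ q) (stage-∈ m∈Z) (stage-antitone (ℕ.≤⇒≤′ m<n) y∈))

        -- The state changes only at elements of `Z`, so at `m` it is still the one formed just
        -- after the last element `x` of `Z` below `m`; hence its threshold is at most `gap x`.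
        last-∈ : ∀ {a} → a ∈ El Z → ∀ {m} → suc a ℕ.≤′ m →
                 ∃ λ x → x ∈ El Z × x ℕ.< m × stage m ∈ˡ reachable (suc x)
        last-∈ {a} a∈Z ℕ.≤′-refl = a , a∈Z , ℕ.≤-refl , proj₂ (run (suc a))
        last-∈ a∈Z (ℕ.≤′-step {m} a<m) with em {m ∈ El Z}
        ... | yes m∈Z = m , m∈Z , ℕ.≤-refl ,
          subst (_∈ˡ reachable (suc m)) (stage-∈ m∈Z) (proj₂ (run (suc m)))
        ... | no m∉Z with x , x∈Z , x<m , p ← last-∈ a∈Z a<m =
          x , x∈Z , ℕ.m≤n⇒m≤1+n x<m , p

        threshold-≤ : ∀ {a m} → a ∈ El Z → m ∈ El Z → a ℕ.< m → threshold (stage m) ℕ.≤ m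
        threshold-≤ a∈Z m∈Z a<m with x , x∈Z , x<m , p ← last-∈ a∈Z (ℕ.≤⇒≤′ a<m) =
          ℕ.≤-trans (≤-maxOn threshold p) (Z-sparse x∈Z m∈Z x<m)

        stage-member : ∀ {a m n} → a ∈ El Z → m ∈ El Z → a ℕ.< m → m ℕ.< n →
                       ∀ {y} → y ∈ Stage n → m ∈ El (f y)
        stage-member {m = m} a∈Z m∈Z a<m m<n y∈ =
          proj₂ (proj₂ (proj₂ (refine (stage m) m))) (threshold-≤ a∈Z m∈Z a<m)
            (subst (λ q → _ ∈ proj₁ q) (stage-∈ m∈Z) (stage-antitone (ℕ.≤⇒≤′ m<n) y∈))

        point : ∀ m → ∃ λ y → y ∈ Stage m
        point m with y , y∈ , _ ← proj₂ (stage m) (const false) ∅∈I = y , y∈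

        beyond : ∀ i → ∃ λ m → i ℕ.< m × m ∈ El Z
        beyond i = infinite⇒unbounded Z Z-inf (suc i)

        -- Once an element of `Z` above `i` has been processed, all points share coordinate `i`, so
        -- any of them can be read.
        limit : ℕ → ℕ
        limit i = proj₁ (point (suc (proj₁ (beyond i)))) i

        horizon : ℕ → ℕ
        horizon k = maxOn (suc ∘ proj₁ ∘ beyond) (upTo k)

        limit-agree : ∀ k n → horizon k ℕ.≤ n → ∀ {y} → y ∈ Stage n → Agree k limit y
        limit-agree k n h≤n y∈ i i<k = stage-agree (proj₂ (proj₂ (beyond i)))
          (ℕ.≤-trans (≤-maxOn (suc ∘ proj₁ ∘ beyond) (∈-upTo⁺ i<k)) h≤n)
          (proj₂ (point (suc (proj₁ (beyond i))))) y∈ i (proj₁ (proj₂ (beyond i)))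

        -- The stages need not be closed, so `limit` may lie outside them. By continuity, whether
        -- `m` belongs to `f limit` is decided by finitely many coordinates, which `limit` shares
        -- with a point of a late stage.
        limit-member : ∀ {a m} → a ∈ El Z → m ∈ El Z → a ℕ.< m → m ∈ El (f limit)
        limit-member {m = m} a∈Z m∈Z a<m with k , near ← f-continuous limit (suc m)
          with y , y∈ ← point (horizon k ⊔ suc m) =
          subst T (sym (near y (limit-agree k _ (ℕ.m≤m⊔n (horizon k) (suc m)) y∈) m ℕ.≤-refl))
            (stage-member a∈Z m∈Z a<m (ℕ.m≤n⊔m (horizon k) (suc m)) y∈)

      sparse-∈ : Z ∈ Mem I
      -- Only an element with a predecessor in `Z` has its threshold controlled, so the elements up
      -- to `a` are given up.
      sparse-∈ with a , _ , a∈Z ← beyond 0 =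
        ⊑*-downward I Z (f limit)
          (⊑*-beyond Z (f limit) (suc a) λ a<n n∈Z → limit-member a∈Z n∈Z a<n)
          (Equivalence.from (range (f limit)) (limit , λ _ → refl))

    analytic-P-¬ordinary : ¬ OrdinaryRamsey I
    analytic-P-¬ordinary = colouring⇒¬ordinary I (λ m n _ _ _ → sparse gap m n)
      λ Y _ (i , hom) → case em {Finite Y} of λ where
        (yes fin) → finite fin
        (no  inf) → sparse-∈ Y inf (sparse-homogeneous gap Y i hom inf)

  tall-analytic-P⇒¬ordinary : ∀ I → Tall I → Analytic (Mem I) → PIdeal I → ¬ OrdinaryRamsey I
  tall-analytic-P⇒¬ordinary I _ (inj₁ empty) _ =
    contradiction (const false , Ideal.finite I ([] , λ ())) empty
  tall-analytic-P⇒¬ordinary I tall (inj₂ (f , f-cont , range)) pIdeal =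
    analytic-P-¬ordinary I tall pIdeal f f-cont range

  -- Convergent sequences in compact metric spaces.

  module Metric (K : MetricSpace) where
    open MetricSpace K
    open IsGeneralMetric isMetric
      using (nonNegative; ≈⇒0; 0⇒≈; triangle; module EqC) renaming (sym to d-sym)

    abstract
      Near : ℕ → Carrier → Carrier → Set
      Near k x y = d x y ≼ radius k

      near-antitone : ∀ {k l x y} → k ℕ.≤ l → Near l x y → Near k x y
      near-antitone {x = x} {y} k≤l = ≼-mono (d x y) (radius-antitone k≤l)

      near-≈ : ∀ k {x y} → x ≈ y → Near k x y
      near-≈ k {x} {y} x≈y with N , p ← proj₁ (≈⇒0 x≈y) (radius k) (0<radius k) =
        N , λ n N≤n → ℚ.≤-trans (p n N≤n) (ℚ.≤-reflexive (ℚ.+-identityˡ (radius k)))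

      near-refl : ∀ k x → Near k x x
      near-refl k x = near-≈ k EqC.refl

      near-all⇒≈ : ∀ {x y} → (∀ k → Near k x y) → x ≈ y
      near-all⇒≈ {x} {y} p = 0⇒≈ (≼-zero (d x y) p , nonNegative)

      -- The metric is symmetric only up to `_≃_`, whose slack the finer index `l` absorbs.
      near-sym : ∀ k → ∃ λ l → ∀ {x y} → Near l x y → Near k y x
      near-sym k with l , r≤ ← radius-small (halve (0<radius k)) =
        l , λ {x} {y} p → subst (d y x ≼_) (halves (radius k))
          (≤-≼-trans (d y x) (d x y) (halve (0<radius k)) (proj₁ (d-sym y x)) (≼-mono (d x y) r≤ p))

      near-trans : ∀ k → ∃ λ l → ∀ {x y z} → Near l x y → Near l y z → Near k x z
      -- A quarter for each distance leaves half of the radius for the slack of the triangle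
      -- inequality.
      near-trans k with l , r≤ ← radius-small (halve (halve (0<radius k))) =
        l , λ {x} {y} {z} p q → ≼-mono (d x z) bound
          (≤-≼-trans (d x z) (d x y + d y z) (halve (0<radius k)) (triangle x y z)
            (+-≼ (d x y) (d y z) (≼-mono (d x y) r≤ p) (≼-mono (d y z) r≤ q)))
        where
        bound : (½ ℚ.* (½ ℚ.* radius k) ℚ.+ ½ ℚ.* (½ ℚ.* radius k)) ℚ.+ ½ ℚ.* radius k ℚ.≤ radius k
        bound = ℚ.≤-reflexive (trans (cong (ℚ._+ ½ ℚ.* radius k) (halves (½ ℚ.* radius k)))
                                     (halves (radius k)))

      near⇒open : ∀ {O} → (∀ {x} → x ∈ O → ∃ λ k → Near k x ⊆ O) → Open K O
      near⇒open p x∈O with k , near⊆O ← p x∈O =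
        constant (radius k) , 0<constant (0<radius k) , λ {y} → near⊆O ∘ <⇒≼ (d _ y)

      open⇒near : ∀ {O} → Open K O → ∀ {x} → x ∈ O → ∃ λ k → Near k x ⊆ O
      open⇒near O-open {x} x∈O with ε , 0<ε , ball⊆O ← O-open x∈O with k , p ← ≼⇒< {ε} 0<ε =
        k , λ {y} → ball⊆O ∘ p (d x y)

      closure⇒near : ∀ {S x} → x ∈ closure K S → ∀ k → ∃ λ y → y ∈ S × Near k x y
      closure⇒near {x = x} x∈ k with y , y∈S , p ← x∈ (constant (radius k)) (0<constant (0<radius k)) =
        y , y∈S , <⇒≼ (d x y) p

      near⇒closure : ∀ {S x} → (∀ k → ∃ λ y → y ∈ S × Near k x y) → x ∈ closure K S
      near⇒closure {x = x} p ε 0<ε with k , q ← ≼⇒< {ε} 0<ε with y , y∈S , near ← p k =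
        y , y∈S , q (d x y) near

      -- `Near k x` is given by a non-strict bound and may fail to be open, so the covering argument
      -- uses this open subset.
      Interior : ℕ → Carrier → Pred Carrier 0ℓ
      Interior k x y = ∃ λ l → Near l y ⊆ Near k x

      interior-open : ∀ k x → Open K (Interior k x)
      interior-open k x = near⇒open λ (l , p) → let m , trans-m = near-trans l in
        m , λ q → m , λ r → p (trans-m q r)

      -- Otherwise every point has a neighbourhood missing `e n` for all large `n` in `Z`. Finitely
      -- many of these cover the space, and a large enough `n` in `Z` escapes them all.
      cluster-point : Compact K U → (e : ℕ → Carrier) → ∀ Z → Infinite Z →
        ∃ λ z → ∀ k N → ∃ λ n → N ℕ.≤ n × n ∈ El Z × Near k z (e n)
      cluster-point (_ , cover) e Z Z-inf = dne λ ¬cluster →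
        let sep : ∀ x → ∃₂ λ k N → ∀ {n} → N ℕ.≤ n → n ∈ El Z → ¬ Near k x (e n)
            sep x = let k , ¬k = ¬∀⇒∃¬ (λ p → ¬cluster (x , p))
                        N , ¬N = ¬∀⇒∃¬ ¬k
                    in k , N , λ N≤n n∈Z near → ¬N (_ , N≤n , n∈Z , near)
            xs , covered = cover (λ x → Interior (proj₁ (sep x)) x)
              (λ x → interior-open (proj₁ (sep x)) x) (λ {x} _ → x , proj₁ (sep x) , id)
            start = proj₁ ∘ proj₂ ∘ sep
            n , N≤n , n∈Z = infinite⇒unbounded Z Z-inf (maxOn start xs)
            x , x∈xs , l , p = find (covered {e n} _)
        in proj₂ (proj₂ (sep x)) (ℕ.≤-trans (≤-maxOn start x∈xs) N≤n) n∈Z (p (near-refl l (e n)))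

    module _ (e : ℕ → Carrier) (Z : 𝒫ω) (z : Carrier)
             (e⟶z : ∀ k → ∃ λ N → ∀ {n} → N ℕ.≤ n → n ∈ El Z → Near k z (e n)) where

      private
        S : Pred Carrier 0ℓ
        S = closure K (image K e Z)

      S-cases : ∀ {x} → x ∈ S → x ≈ z ⊎ ∃ λ n → n ∈ El Z × x ≈ e n
      S-cases {x} x∈S = dne λ ¬cases →
        let k , x≁z = ¬∀⇒∃¬ (¬cases ∘ inj₁ ∘ near-all⇒≈ {x} {z})
            l , trans-k = near-trans k
            j , sym-l = near-sym l
            N , near-z = e⟶z j
            sep : ∀ n → ∃ λ i → n ∈ El Z → ¬ Near i x (e n)
            sep n = case em {n ∈ El Z} of λ where
              (yes n∈Z) → let i , ¬near = ¬∀⇒∃¬ λ p → ¬cases (inj₂ (n , n∈Z , near-all⇒≈ p))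
                          in i , λ _ → ¬near
              (no  n∉Z) → 0 , λ n∈Z → contradiction n∈Z n∉Z
            -- Fine enough to separate `x` from `z` and from the finitely many terms `e n` with `n`
            -- below `N`.
            M = l ⊔ maxOn (proj₁ ∘ sep) (upTo N)
            m , trans-M = near-trans M
            y , (n , n∈Z , en≈y) , near = closure⇒near x∈S m
            x~en : Near M x (e n)
            x~en = trans-M near (near-≈ m (EqC.sym en≈y))
        in case n ℕ.<? N of λ where
          (yes n<N) → proj₂ (sep n) n∈Z (near-antitone
            (ℕ.≤-trans (≤-maxOn (proj₁ ∘ sep) (∈-upTo⁺ n<N)) (ℕ.m≤n⊔m l _)) x~en)
          (no n≮N) → x≁z (trans-k (near-antitone (ℕ.m≤m⊔n l _) x~en)
            (sym-l (near-z (ℕ.≮⇒≥ n≮N) n∈Z)))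

      S-respects : ∀ {x y} → x ≈ y → x ∈ S → y ∈ S
      S-respects x≈y x∈S = near⇒closure λ k →
        let l , trans-k = near-trans k
            w , w∈ , near = closure⇒near x∈S l
        in w , w∈ , trans-k (near-≈ l (EqC.sym x≈y)) near

      e∈S : ∀ {n} → n ∈ El Z → e n ∈ S
      e∈S {n} n∈Z = near⇒closure λ k → e n , (n , n∈Z , EqC.refl) , near-refl k (e n)

      module _ (Z-inf : Infinite Z) where

        z∈S : z ∈ S
        z∈S = near⇒closure λ k →
          let N , near-z = e⟶z k
              n , N≤n , n∈Z = infinite⇒unbounded Z Z-inf N
          in e n , (n , n∈Z , EqC.refl) , near-z N≤n n∈Z

        -- The member of the cover around `z` contains the tail; the finitely many other terms need
        -- one member each.
        S-compact : Compact K S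
        S-compact = S-respects , λ O O-open S⊆⋃O →
          let i₀ , z∈O = S⊆⋃O z∈S
              k , near⊆O = open⇒near (O-open i₀) z∈O
              N , near-z = e⟶z k
              respects : ∀ i {x y} → x ≈ y → y ∈ O i → x ∈ O i
              respects i x≈y y∈O = let j , near⊆ = open⇒near (O-open i) y∈O
                                   in near⊆ (near-≈ j (EqC.sym x≈y))
              index : ∀ n → ∃ λ i → n ∈ El Z → e n ∈ O i
              index n = case em {n ∈ El Z} of λ where
                (yes n∈Z) → let i , en∈O = S⊆⋃O (e∈S n∈Z) in i , λ _ → en∈O
                (no  n∉Z) → i₀ , λ n∈Z → contradiction n∈Z n∉Z
          in i₀ ∷ map (proj₁ ∘ index) (upTo N) , λ x∈S → case S-cases x∈S of λ where
            (inj₁ x≈z) → here (respects i₀ x≈z z∈O)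
            (inj₂ (n , n∈Z , x≈en)) → case n ℕ.<? N of λ where
              (yes n<N) → there (lose (∈-map⁺ (proj₁ ∘ index) (∈-upTo⁺ n<N))
                                      (respects _ x≈en (proj₂ (index n) n∈Z)))
              (no  n≮N) → here (respects i₀ x≈en (near⊆O (near-z (ℕ.≮⇒≥ n≮N) n∈Z)))

        S-∈ : (𝒦 : σIdeal K) → S ∈ σIdeal.Mem 𝒦
        S-∈ 𝒦 = σIdeal.union 𝒦 (λ n → _≈ point n) (λ n → σIdeal.singleton 𝒦 (point n)) S-compact
          (S⊆ , λ (n , x≈) → S-respects (EqC.sym x≈) (point-∈ n))
          where
          point : ℕ → Carrier
          point ℕ.zero  = z
          point (suc n) = if Z n then e n else z

          point-∈ : ∀ n → point n ∈ S
          point-∈ ℕ.zero = z∈S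
          point-∈ (suc n) with Z n in Zn
          ... | true  = e∈S (Equivalence.from T-≡ Zn)
          ... | false = z∈S

          S⊆ : S ⊆ ⋃ ℕ (λ n → _≈ point n)
          S⊆ x∈S with S-cases x∈S
          ... | inj₁ x≈z = 0 , x≈z
          ... | inj₂ (n , n∈Z , x≈en) = suc n ,
            subst (λ b → _ ≈ (if b then e n else z)) (sym (Equivalence.to T-≡ n∈Z)) x≈en

  -- Topologically represented ideals.

  represented⇒¬ordinary : ∀ J → TopologicallyRepresented J → ¬ OrdinaryRamsey J
  represented⇒¬ordinary J rep = colouring⇒¬ordinary J (λ m n _ _ _ → lex distances m n)
    λ Y _ (i , hom) → case em {Finite Y} of λ where
      (yes fin) → Ideal.finite J fin
      (no  inf) → let z , z-cluster = cluster-point K-compact e Y inf in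
        Equivalence.from (represents Y) (S-∈ e Y z (converges Y i hom z z-cluster) inf 𝒦)
    where
    open TopologicallyRepresented rep
    open MetricSpace K
    open Metric K

    distances : ℕ → ℕ → Bool
    distances n k = let l , m = unpair k in does (em {Near l (e m) (e n)})

    -- By density some `e m` is near the cluster point `z`. The bit comparing `e n` with `e m` is
    -- eventually constant along `Y`, and a late term near `z` shows it to be `true`; so all late
    -- terms are near `e m` and hence near `z`.
    converges : ∀ Y i → HomogeneousFor (lex distances) Y i → ∀ z →
      (∀ k N → ∃ λ n → N ℕ.≤ n × n ∈ El Y × Near k z (e n)) →
      ∀ k → ∃ λ N → ∀ {n} → N ℕ.≤ n → n ∈ El Y → Near k z (e n)
    converges Y i hom z z-cluster k =
      let l , trans-k = near-trans k
          p , trans-l = near-trans l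
          q , sym-p = near-sym p
          t , trans-q = near-trans (q ⊔ l)
          y , y∈D , z~y = closure⇒near (D-dense z) t
          m , em≈y = e-onto-D y∈D
          z~em : Near (q ⊔ l) z (e m)
          z~em = trans-q z~y (near-≈ t (EqC.sym em≈y))
          j , uj = unpair-surjective l m
          b , N , const-b = lex-convergent distances Y i hom j
          const′ : ∀ {n} → N ℕ.≤ n → n ∈ El Y → does (em {Near l (e m) (e n)}) ≡ b
          const′ {n} N≤n n∈Y = trans
            (cong (λ (l , m) → does (em {Near l (e m) (e n)})) (sym uj)) (const-b N≤n n∈Y)
          n₀ , N≤n₀ , n₀∈Y , z~en₀ = z-cluster p N
          em~en₀ : Near l (e m) (e n₀)
          em~en₀ = trans-l (sym-p (near-antitone (ℕ.m≤m⊔n q l) z~em)) z~en₀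
      in N , λ N≤n n∈Y → trans-k (near-antitone (ℕ.m≤n⊔m q l) z~em)
        (does-true em (trans (const′ N≤n n∈Y)
          (trans (sym (const′ N≤n₀ n₀∈Y)) (dec-true em em~en₀))))
      where open IsGeneralMetric isMetric using (module EqC)

theoremB : (∀ {ℓ} → ExcludedMiddle ℓ) →
    ((I : ℕ → Ideal) → (∀ n → Tall (I n) × Analytic (Mem (I n)) × PIdeal (I n)) → ¬ Ramsey (⋂ᴵ I))
    × ((I : ℕ → Ideal) → (∀ n → ¬ OrdinaryRamsey (I n)) → ¬ Ramsey (⋂ᴵ I))
    × ((I : ℕ → Ideal) → (∀ n → TopologicallyRepresented (I n)) → ¬ Ramsey (⋂ᴵ I))
theoremB em =
    (λ I h → ⋂-¬ramsey I λ n → let tall , analytic , pIdeal = h n in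
       tall-analytic-P⇒¬ordinary (I n) tall analytic pIdeal)
  , ⋂-¬ramsey
  , (λ I h → ⋂-¬ramsey I λ n → represented⇒¬ordinary (I n) (h n))
  where open Classical em
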